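{- For all integers $n,d,k\ge0$, $T(n,\omega^d\cdot k)\le P(n,\omega^d\cdot k)$.
   Context: $[c]=\{1,\dots,c\}$; ordinals are identified with sets of smaller ordinals; $\approx$ is order-equivalence; $\binom{S}{n}$ is the set of $n$-element subsets. $T(n,S)$ is the least $t\in\mathbb{N}$ such that for every $c\ge1$ and every $\mathrm{COL}:\binom{S}{n}\to[c]$ there is $S'\subseteq S$, $S'\approx S$, with $|\mathrm{COL}(\binom{S'}{n})|\le t$ ($\infty$ if none). Every $\beta<\omega^d\cdot k$ is uniquely $\omega^d b+\sum_{j<d}\omega^j a_j$ with $0\le b<k$, $a_j\in\mathbb{N}$. A coloring rule (CR) on $\binom{\omega^d\cdot k}{n}$ is a pair $(\mathcal{Y},\preceq)$ with $\mathcal{Y}:\{1,\dots,n\}\to\{0,\dots,k-1\}$ and $\preceq$ a total preorder on $I=\{(i,j):1\le i\le n,0\le j<d\}$ (with induced equivalence $\equiv$ and strict part $\prec$) such that: (1) if $d\ge1$, $(i,0)\prec(i',0)$ for $i<i'$; if $d=0$, $\mathcal{Y}(i)<\mathcal{Y}(i')$ for $i<i'$; (2) $(i,j)\equiv(i',j)$ for some $j$ implies $\mathcal{Y}(i)=\mathcal{Y}(i')$; (3) $(i,j)\prec(i,j')$ for $j>j'$; (4) $(i,j)\equiv(i',j')$ implies $j=j'$; (5) for $j>0$, $(i,j)\not\equiv(i',j)$ implies $(i,j-1)\not\equiv(i',j-1)$. $P(n,\omega^d\cdot k)$ is the total number of CRs on $\binom{\omega^d\cdot k}{n}$. -}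

module Defs where

open import Axiom.ExcludedMiddle using (ExcludedMiddle)
open import Data.Bool.Base using (Bool; true; false)
import Data.Bool.Properties as Bool
open import Data.Fin.Base as Fin using (Fin; toℕ)
import Data.Fin.Properties as Fin
open import Data.Fin.Subset using (Subset; ∣_∣)
open import Data.List.Base using (List; []; _∷_; allFin; cartesianProduct; cartesianProductWith; filter; length)
open import Data.Nat.Base using (ℕ; zero; suc; _≤_)
import Data.Nat.Properties as ℕ
open import Data.Product.Base using (Σ; ∃; _×_; _,_; proj₁; proj₂)
open import Data.Product.Relation.Binary.Lex.Strict using (×-strictTotalOrder)
open import Data.Vec.Base as Vec using (Vec; []; _∷_; lookup)
import Data.Vec.Relation.Binary.Pointwise.Inductive as Pointwise
open import Data.Vec.Relation.Unary.All using (All)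
open import Data.Vec.Relation.Unary.Linked using (Linked)
open import Function.Bundles using (_⟶ₛ_; _⟨$⟩_)
open import Level using (0ℓ)
open import Relation.Binary.Bundles using (Setoid; StrictTotalOrder)
import Relation.Binary.Construct.On as On
open import Relation.Binary.Core using (Rel)
open import Relation.Binary.Definitions using (Decidable)
open import Relation.Binary.Morphism.Structures using (IsOrderIsomorphism)
open import Relation.Binary.PropositionalEquality as ≡ using (_≡_; refl)
open import Relation.Binary.Structures using (IsTotalPreorder)
open import Relation.Nullary.Construct.Add.Supremum using (_⁺; [_]; ⊤⁺)
open import Relation.Nullary.Decidable using (Dec; yes; no; does; map′; ¬?; _×-dec_; _⊎-dec_; _→-dec_)
open import Relation.Nullary.Negation using (¬_)
open import Relation.Unary using (Pred) renaming (Decidable to Decidable₁)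

-- Strict total orders, up to the setoid equality they carry, play the role of
-- the sets S.  An ordinal is given by its order type.
Order : Set₁
Order = StrictTotalOrder 0ℓ 0ℓ 0ℓ

-- α · β consists of β copies of α, so the β-coordinate is compared first.
infixl 7 _·_
_·_ : Order → Order → Order
α · β = ×-strictTotalOrder β α

fin : ℕ → Order
fin = Fin.<-strictTotalOrder

ω : Order
ω = ℕ.<-strictTotalOrder

-- Unfolding, an element of ω^ d · fin k is (b , a_{d-1} , … , a_0 , zero), the
-- Cantor normal form ω^d b + ω^{d-1} a_{d-1} + … + a_0, ordered
-- lexicographically.
infixr 8 ω^_
ω^_ : ℕ → Order
ω^ zero  = fin 1
ω^ suc d = ω^ d · ω

-- Characteristic functions; these are all the subsets since excluded middle is
-- assumed wherever they are used.
SubsetOf : Order → Set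
SubsetOf S = StrictTotalOrder.Eq.setoid S ⟶ₛ ≡.setoid Bool

Members : (S : Order) → SubsetOf S → Pred (StrictTotalOrder.Carrier S) 0ℓ
Members S S′ x = S′ ⟨$⟩ x ≡ true

_↾_ : (S : Order) → SubsetOf S → Order
S ↾ S′ = On.strictTotalOrder {B = ∃ (Members S S′)} S proj₁

infix 4 _≃ₒ_
_≃ₒ_ : Order → Order → Set
A ≃ₒ B = ∃ λ (f : A.Carrier → B.Carrier) → IsOrderIsomorphism A._≈_ B._≈_ A._<_ B._<_ f
  where
  module A = StrictTotalOrder A
  module B = StrictTotalOrder B

-- An n-element subset is represented by its increasing enumeration; equality
-- is equality of the enumerated elements.
binom : Order → ℕ → Setoid 0ℓ 0ℓ
binom S n = On.setoid {B = Σ (Vec S.Carrier n) (Linked S._<_)}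
                      (Pointwise.setoid S.Eq.setoid n) proj₁
  where module S = StrictTotalOrder S

Within : (S : Order) {n : ℕ} → SubsetOf S → Pred (Setoid.Carrier (binom S n)) 0ℓ
Within S S′ X = All (Members S S′) (proj₁ X)

-- Excluded middle is a parameter: it makes the image of a colouring a finite
-- set with a cardinality, and makes T a total function.
module Classical (em : ExcludedMiddle 0ℓ) where

  image : (S : Order) {n c : ℕ} → binom S n ⟶ₛ ≡.setoid (Fin c) → SubsetOf S → Subset c
  image S COL S′ = Vec.tabulate λ r → does (em {∃ λ X → Within S S′ X × COL ⟨$⟩ X ≡ r})

  AtMost : ℕ → Order → ℕ → Set
  AtMost n S t = (c : ℕ) → 1 ≤ c → (COL : binom S n ⟶ₛ ≡.setoid (Fin c)) →
    ∃ λ (S′ : SubsetOf S) → (S ↾ S′) ≃ₒ S × ∣ image S COL S′ ∣ ≤ t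

  IsLeast : (ℕ → Set) → ℕ → Set
  IsLeast Q t = Q t × (∀ s → Q s → t ≤ s)

  T : ℕ → Order → ℕ ⁺
  T n S with em {∃ (IsLeast (AtMost n S))}
  ... | yes (t , _) = [ t ]
  ... | no  _       = ⊤⁺

-- The index i ∈ {1 , … , n} is shifted to Fin n.
record IsCR {n d k : ℕ} (Y : Fin n → Fin k) (_≼_ : Rel (Fin n × Fin d) 0ℓ) : Set where

  _∼_ : Rel (Fin n × Fin d) 0ℓ
  x ∼ y = x ≼ y × y ≼ x

  _≺_ : Rel (Fin n × Fin d) 0ℓ
  x ≺ y = x ≼ y × ¬ y ≼ x

  field
    isTotalPreorder : IsTotalPreorder _≡_ _≼_

    -- Some j with toℕ j ≡ 0 exists exactly when d ≥ 1.
    cond₁ : ∀ i i′ (j : Fin d) → toℕ j ≡ 0 → i Fin.< i′ → (i , j) ≺ (i′ , j)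
    cond₁′ : d ≡ 0 → ∀ i i′ → i Fin.< i′ → Y i Fin.< Y i′

    cond₂ : ∀ i i′ j → (i , j) ∼ (i′ , j) → Y i ≡ Y i′
    cond₃ : ∀ i j j′ → j Fin.> j′ → (i , j) ≺ (i , j′)
    cond₄ : ∀ i i′ j j′ → (i , j) ∼ (i′ , j′) → j ≡ j′

    -- j⁻ is j - 1.
    cond₅ : ∀ i i′ (j j⁻ : Fin d) → toℕ j ≡ suc (toℕ j⁻) →
            ¬ (i , j) ∼ (i′ , j) → ¬ (i , j⁻) ∼ (i′ , j⁻)

module _ {n d k : ℕ} (Y : Fin n → Fin k) {_≼_ : Rel (Fin n × Fin d) 0ℓ}
         (_≼?_ : Decidable _≼_) where

  private
    I = Fin n × Fin d

    ∀I? : {Q : I → Set} → Decidable₁ Q → Dec (∀ x → Q x)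
    ∀I? Q? = map′ (λ f x → f (proj₁ x) (proj₂ x)) (λ f i j → f (i , j))
                  (Fin.all? λ i → Fin.all? λ j → Q? (i , j))

    _∼?_ : (x y : I) → Dec (x ≼ y × y ≼ x)
    x ∼? y = x ≼? y ×-dec y ≼? x

    _≺?_ : (x y : I) → Dec (x ≼ y × ¬ y ≼ x)
    x ≺? y = x ≼? y ×-dec ¬? (y ≼? x)

    isTotalPreorder? : Dec (IsTotalPreorder _≡_ _≼_)
    isTotalPreorder? = map′
      (λ (r , t , tot) → record
        { isPreorder = record
          { isEquivalence = ≡.isEquivalence
          ; reflexive     = λ where refl → r _
          ; trans         = λ {x} {y} {z} → t x y z
          }
        ; total = tot
        })
      (λ p → let open IsTotalPreorder p using (reflexive; trans; total) in
        (λ x → reflexive refl) , (λ x y z → trans) , total)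
      ((∀I? λ x → x ≼? x)
        ×-dec (∀I? λ x → ∀I? λ y → ∀I? λ z → x ≼? y →-dec (y ≼? z →-dec x ≼? z))
        ×-dec (∀I? λ x → ∀I? λ y → x ≼? y ⊎-dec y ≼? x))

  isCR? : Dec (IsCR Y _≼_)
  isCR? = map′
    (λ (p , c₁ , c₁′ , c₂ , c₃ , c₄ , c₅) → record
      { isTotalPreorder = p ; cond₁ = c₁ ; cond₁′ = c₁′ ; cond₂ = c₂
      ; cond₃ = c₃ ; cond₄ = c₄ ; cond₅ = c₅ })
    (λ r → let open IsCR r in
      isTotalPreorder , cond₁ , cond₁′ , cond₂ , cond₃ , cond₄ , cond₅)
    (isTotalPreorder?
      ×-dec (Fin.all? λ i → Fin.all? λ i′ → Fin.all? λ j →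
              toℕ j ℕ.≟ 0 →-dec (i Fin.<? i′ →-dec (i , j) ≺? (i′ , j)))
      ×-dec (d ℕ.≟ 0 →-dec (Fin.all? λ i → Fin.all? λ i′ →
              i Fin.<? i′ →-dec Y i Fin.<? Y i′))
      ×-dec (Fin.all? λ i → Fin.all? λ i′ → Fin.all? λ j →
              (i , j) ∼? (i′ , j) →-dec Y i Fin.≟ Y i′)
      ×-dec (Fin.all? λ i → Fin.all? λ j → Fin.all? λ j′ →
              j′ Fin.<? j →-dec (i , j) ≺? (i , j′))
      ×-dec (Fin.all? λ i → Fin.all? λ i′ → Fin.all? λ j → Fin.all? λ j′ →
              (i , j) ∼? (i′ , j′) →-dec j Fin.≟ j′)
      ×-dec (Fin.all? λ i → Fin.all? λ i′ → Fin.all? λ j → Fin.all? λ j⁻ →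
              toℕ j ℕ.≟ suc (toℕ j⁻) →-dec
              (¬? ((i , j) ∼? (i′ , j)) →-dec ¬? ((i , j⁻) ∼? (i′ , j⁻)))))

-- To count rules without function extensionality, 𝒴 and ≼ are given by their
-- tables of values, so that two rules are the same exactly when their tables
-- are propositionally equal.
Table : ℕ → ℕ → Set
Table n d = Vec (Vec (Vec (Vec Bool d) n) d) n

⟦_⟧ : {n d : ℕ} → Table n d → Rel (Fin n × Fin d) 0ℓ
⟦ R ⟧ (i , j) (i′ , j′) = lookup (lookup (lookup (lookup R i) j) i′) j′ ≡ true

Candidate : ℕ → ℕ → ℕ → Set
Candidate n d k = Vec (Fin k) n × Table n d

CR : (n d k : ℕ) → Candidate n d k → Set
CR n d k (Y , R) = IsCR (lookup Y) ⟦ R ⟧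

CR? : (n d k : ℕ) → Decidable₁ (CR n d k)
CR? n d k (Y , R) = isCR? (lookup Y) {⟦ R ⟧} (λ _ _ → _ Bool.≟ true)

vectors : {A : Set} → List A → (n : ℕ) → List (Vec A n)
vectors xs zero    = [] ∷ []
vectors xs (suc n) = cartesianProductWith _∷_ xs (vectors xs n)

-- Every candidate, listed exactly once.
candidates : (n d k : ℕ) → List (Candidate n d k)
candidates n d k = cartesianProduct
  (vectors (allFin k) n)
  (vectors (vectors (vectors (vectors (false ∷ true ∷ []) d) n) d) n)

-- P n d k is P(n , ω^d · k).
P : ℕ → ℕ → ℕ → ℕ
P n d k = length (filter (CR? n d k) (candidates n d k))

{-# OPTIONS --safe #-}

-- View ω^d · k as the leaves of a forest of k trees of height d, and number the
-- nodes of the forest injectively so that numbers increase from parent to child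
-- and from left to right among siblings.  Given h : ℕ → ℕ strictly increasing,
-- moving each edge into a node numbered v to position h v embeds ω^d · k into
-- itself.  Listing n elements of the image by increasing last number, the order
-- among the numbers of all their ancestors is a coloring rule.  By Ramsey's theorem,
-- h can be chosen so that the color of an n-subset of the image depends only on its
-- rule, whence at most P(n , ω^d · k) colors.
module Submission where

open import Axiom.ExcludedMiddle using (ExcludedMiddle)
open import Data.Bool.Base using (Bool; true; false; if_then_else_)
open import Data.Bool.Properties using (T-≡)
open import Data.Fin.Base as Fin using (Fin; zero; suc; toℕ; fromℕ; fromℕ<; opposite; combine)
import Data.Fin.Properties as Fin
open import Data.Fin.Subset using (Subset; ∣_∣; _∈_; ⊥; ⁅_⁆; _∪_)
open import Data.Fin.Subset.Properties using
  (p⊆q⇒∣p∣≤∣q∣; p⊂q⇒∣p∣<∣q∣; ∣p∣≤∣x∷p∣; ∣⊥∣≡0; ∣⊤∣≡n; ∈⊤; x∈p∪q⁺; x∈⁅x⁆; ∪-identityˡ)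
open import Data.List.Base using (List; []; _∷_; allFin; cartesianProduct; filter; length)
import Data.List.Membership.Propositional as List
open import Data.List.Membership.Propositional.Properties using
  (∈-cartesianProduct⁺; ∈-cartesianProductWith⁺; ∈-allFin; ∈-filter⁺)
open import Data.List.Relation.Unary.Any using (here; there)
open import Data.Nat.Base
open import Data.Nat.Induction using (<-rec)
open import Data.Nat.Properties
open import Data.Product.Base as Product using (∃; _×_; _,_; proj₁; proj₂)
open import Data.Sum.Base as Sum using (inj₁; inj₂)
open import Data.Vec.Base as Vec using (Vec; []; _∷_; lookup; tabulate; concat)
open import Data.Vec.Membership.Propositional using () renaming (_∈_ to _∈ᵥ_)
open import Data.Vec.Membership.Propositional.Properties using (∈-lookup)
open import Data.Vec.Properties using
  (map-∘; lookup∘tabulate; lookup⇒[]=; []=⇒lookup; lookup-map; lookup-concat;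
   tabulate-∘; tabulate-cong; tabulate∘lookup)
import Data.Vec.Relation.Binary.Pointwise.Inductive as Pointwise
open import Data.Vec.Relation.Unary.All as All using (All; []; _∷_)
import Data.Vec.Relation.Unary.All.Properties as All
open import Data.Vec.Relation.Unary.Any as Any using (here; there)
import Data.Vec.Relation.Unary.Any.Properties as Any
open import Data.Vec.Relation.Unary.Linked as Linked using (Linked; []; [-]; _∷_)
import Data.Vec.Relation.Unary.Linked.Properties as Linked
open import Function.Base using (_∘_; id)
open import Function.Bundles using (_⇔_; Equivalence; mk⇔; _⟶ₛ_; _⟨$⟩_; Func)
open import Function.Definitions using (Injective; StrictlySurjective)
import Function.Properties.Equivalence as ⇔
open import Level using (0ℓ)
open import Relation.Binary.Bundles using (Setoid; StrictTotalOrder)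
open import Relation.Binary.Construct.Add.Supremum.NonStrict _≤_ using (_≤⁺_)
open import Relation.Binary.Construct.Add.Supremum.NonStrict _≤_ using () renaming ([_] to [≤_])
open import Relation.Binary.Core using (Rel)
open import Relation.Binary.Definitions using (Irreflexive; Monotonic₁; Transitive; tri<; tri≈; tri>)
open import Relation.Binary.PropositionalEquality hiding ([_])
open import Relation.Nullary.Construct.Add.Supremum using ([_])
open import Relation.Nullary.Decidable using (Dec; yes; no; does; dec-true; dec-false; decidable-stable)
open import Relation.Nullary.Negation using (¬_; contradiction)
open import Defs

private variable
  A : Set
  c d k m n p N : ℕ

-- Vectors, strictly increasing sequences and finite suprema

∈-vectors : {xs : List A} (v : Vec A n) → (∀ i → lookup v i List.∈ xs) → v List.∈ vectors xs n
∈-vectors []      _ = here refl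
∈-vectors (x ∷ v) v∈ = ∈-cartesianProductWith⁺ _∷_ (v∈ zero) (∈-vectors v (v∈ ∘ suc))

StrictlyMonotone : (ℕ → ℕ) → Set
StrictlyMonotone = Monotonic₁ _<_ _<_

strictlyMonotone : {f : ℕ → ℕ} → (∀ n → f n < f (suc n)) → StrictlyMonotone f
strictlyMonotone {f} step m<n = go (≤⇒≤′ m<n)
  where
  go : ∀ {m n} → suc m ≤′ n → f m < f n
  go ≤′-refl           = step _
  go (≤′-step m<n) = <-trans (go m<n) (step _)

Increasing : Vec ℕ n → Set
Increasing = Linked _<_

map-increasing : ∀ {f} → StrictlyMonotone f → {v : Vec ℕ n} → Increasing v → Increasing (Vec.map f v)
map-increasing f-mono = Linked.map⁺ ∘ Linked.map f-mono

tabulate-linked : {R : Rel A 0ℓ} (f : Fin n → A) → (∀ {i j} → i Fin.< j → R (f i) (f j)) →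
                  Linked R (tabulate f)
tabulate-linked {n = 0}           f f-mono = []
tabulate-linked {n = 1}           f f-mono = [-]
tabulate-linked {n = suc (suc n)} f f-mono = f-mono z<s ∷ tabulate-linked (f ∘ suc) (f-mono ∘ s<s)

sup : (Fin n → ℕ) → ℕ
sup {zero}  f = 0
sup {suc n} f = f zero ⊔ sup (f ∘ suc)

≤sup : (f : Fin n → ℕ) (i : Fin n) → f i ≤ sup f
≤sup f zero    = m≤m⊔n _ _
≤sup f (suc i) = ≤-trans (≤sup (f ∘ suc) i) (m≤n⊔m _ _)

sup-least : (f : Fin n → ℕ) {b : ℕ} → (∀ i → f i ≤ b) → sup f ≤ b
sup-least {zero}  f f≤b = z≤n
sup-least {suc n} f f≤b = ⊔-lub (f≤b zero) (sup-least (f ∘ suc) (f≤b ∘ suc))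

above-zero : {v : Vec ℕ n} → All (0 <_) v → ∃ λ v′ → v ≡ Vec.map suc v′
above-zero [] = [] , refl
above-zero (z<s ∷ 0<v) = let v′ , eq = above-zero 0<v in _ ∷ v′ , cong (_ ∷_) eq

linked⇒all : ∀ {x} {v : Vec ℕ n} → Increasing (x ∷ v) → All (x <_) v
linked⇒all [-]         = []
linked⇒all (x<y ∷ inc) = Linked.Linked⇒All <-trans x<y inc

-- Ramsey's theorem

module Ramsey (em : ExcludedMiddle 0ℓ) where

  -- If every color stopped occurring from some bound on, then the color of the supremum of these
  -- bounds would occur beyond its own bound. So some color recurs beyond every bound, and `s`
  -- collects its occurrences one after another.
  pigeonhole : (f : ℕ → Fin c) → ∃ λ r → ∃ λ s → StrictlyMonotone s × (∀ n → f (s n) ≡ r)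
  pigeonhole f with Fin.all? (λ r → em {∃ λ b → ∀ m → b ≤ m → f m ≢ r})
  ... | yes bounded = contradiction refl (proj₂ (bounded (f b)) b (≤sup (proj₁ ∘ bounded) (f b)))
    where b = sup (proj₁ ∘ bounded)
  ... | no ¬bounded =
    r , s , strictlyMonotone (λ n → proj₁ (proj₂ (next (suc (s n))))) , s-colour
    where
    witness = Fin.¬∀⟶∃¬ _ _ (λ r → em) ¬bounded
    r = proj₁ witness
    next : ∀ b → ∃ λ m → b ≤ m × f m ≡ r
    next b = decidable-stable em λ ¬next →
      proj₂ witness (b , λ m b≤m fm≡r → ¬next (m , b≤m , fm≡r))
    s : ℕ → ℕ
    s zero    = proj₁ (next 0)
    s (suc n) = proj₁ (next (suc (s n)))
    s-colour : ∀ n → f (s n) ≡ r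
    s-colour zero    = proj₂ (proj₂ (next 0))
    s-colour (suc n) = proj₂ (proj₂ (next (suc (s n))))

  Homogeneous : (Vec ℕ p → Fin c) → (ℕ → ℕ) → Fin c → Set
  Homogeneous χ h r = ∀ {v} → Increasing v → χ (Vec.map h v) ≡ r

  -- Peel off 0, make the color of 0 ∷ v independent of v, and continue inside the
  -- set so obtained: the color of a set then depends on its least element only.
  module EndHomogeneous
    (ramseyₚ : (χ : Vec ℕ p → Fin c) → ∃ λ h → ∃ λ r → StrictlyMonotone h × Homogeneous χ h r)
    where

    module _ (χ : Vec ℕ (suc p) → Fin c) where
      private step = ramseyₚ (λ v → χ (0 ∷ Vec.map suc v))

      thin : ℕ → ℕ
      thin = suc ∘ proj₁ step

      colour₀ : Fin c
      colour₀ = proj₁ (proj₂ step)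

      thin-mono : StrictlyMonotone thin
      thin-mono = s<s ∘ proj₁ (proj₂ (proj₂ step))

      thin-colour : ∀ {v} → Increasing v → χ (0 ∷ Vec.map thin v) ≡ colour₀
      thin-colour {v} inc =
        trans (cong (χ ∘ (0 ∷_)) (map-∘ suc _ v)) (proj₂ (proj₂ (proj₂ step)) inc)

      rest : Vec ℕ (suc p) → Fin c
      rest = χ ∘ Vec.map thin

    points : (Vec ℕ (suc p) → Fin c) → ℕ → ℕ
    points χ zero    = 0
    points χ (suc m) = thin χ (points (rest χ) m)

    colours : (Vec ℕ (suc p) → Fin c) → ℕ → Fin c
    colours χ zero    = colour₀ χ
    colours χ (suc m) = colours (rest χ) m

    points-mono : ∀ χ → StrictlyMonotone (points χ)
    points-mono χ {zero}  {suc n} _   = z<s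
    points-mono χ {suc m} {suc n} m<n = thin-mono χ (points-mono (rest χ) (s<s⁻¹ m<n))

    map-points : ∀ χ (v : Vec ℕ n) → Vec.map (points χ) (Vec.map suc v) ≡
                                     Vec.map (thin χ) (Vec.map (points (rest χ)) v)
    map-points χ v = trans (sym (map-∘ _ suc v)) (map-∘ (thin χ) _ v)

    increasing-unsuc : {v : Vec ℕ n} → Increasing (Vec.map suc v) → Increasing v
    increasing-unsuc = Linked.map s<s⁻¹ ∘ Linked.map⁻

    points-colour : ∀ χ m {v} → Increasing (m ∷ v) →
                    χ (Vec.map (points χ) (m ∷ v)) ≡ colours χ m
    points-colour χ m inc
      -- Entries above `m` are positive, hence successors, so by `map-points` their images lie in
      -- the range of `thin χ`.
      with v′ , refl ← above-zero (All.map (≤-<-trans z≤n) (linked⇒all inc))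
      with m
    ... | zero   = trans (cong (χ ∘ (0 ∷_)) (map-points χ v′))
                         (thin-colour χ (map-increasing (points-mono (rest χ))
                                                        (increasing-unsuc (Linked.tail inc))))
    ... | suc m′ = trans (cong χ (map-points χ (m′ ∷ v′)))
                         (points-colour (rest χ) m′ (increasing-unsuc {v = m′ ∷ v′} inc))

  -- Induction on `p`. Along `points χ` the color of a set depends only on its least element; the
  -- pigeonhole principle then selects least elements of one color.
  ramsey : ∀ p (χ : Vec ℕ p → Fin c) → ∃ λ h → ∃ λ r → StrictlyMonotone h × Homogeneous χ h r
  ramsey zero    χ = id , χ [] , id , λ { {[]} _ → refl }
  ramsey (suc p) χ = points χ ∘ s , r , points-mono χ ∘ s-mono , homogeneous
    where
    open EndHomogeneous (ramsey p)
    hole = pigeonhole (colours χ)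
    r = proj₁ hole
    s = proj₁ (proj₂ hole)
    s-mono : StrictlyMonotone s
    s-mono = proj₁ (proj₂ (proj₂ hole))
    homogeneous : Homogeneous χ (points χ ∘ s) r
    homogeneous {m ∷ v} inc = begin
      χ (Vec.map (points χ ∘ s) (m ∷ v))         ≡⟨ cong χ (map-∘ (points χ) s (m ∷ v)) ⟩
      χ (Vec.map (points χ) (Vec.map s (m ∷ v))) ≡⟨ points-colour χ (s m) (map-increasing s-mono inc) ⟩
      colours χ (s m)                            ≡⟨ proj₂ (proj₂ (proj₂ hole)) m ⟩
      r                                          ∎
      where open ≡-Reasoning

  -- Homogeneity survives further thinning, so the colorings of a finite list can be treated one
  -- after another.
  ramsey-family : (as : List A) (χ : A → Vec ℕ p → Fin c) → ∃ λ h → StrictlyMonotone h ×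
                  (∀ {a} → a List.∈ as → ∃ λ r → Homogeneous (χ a) h r)
  ramsey-family []       χ = id , id , λ ()
  ramsey-family {p = p} (a ∷ as) χ =
    let h₁ , r , h₁-mono , hom₁ = ramsey p (χ a)
        h₂ , h₂-mono , hom₂ = ramsey-family as (λ b → χ b ∘ Vec.map h₁)

        homogeneous : ∀ {b} → b List.∈ a ∷ as → ∃ λ r → Homogeneous (χ b) (h₁ ∘ h₂) r
        homogeneous = λ where
          (here refl) → r , λ {v} inc →
            trans (cong (χ a) (map-∘ h₁ h₂ v)) (hom₁ (map-increasing h₂-mono inc))
          (there b∈)  → let r , hom = hom₂ b∈ in r , λ {v} inc →
            trans (cong (χ _) (map-∘ h₁ h₂ v)) (hom inc)
    in h₁ ∘ h₂ , h₁-mono ∘ h₂-mono , homogeneous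

-- Ranks and order types of tuples

below : (Fin N → ℕ) → Fin N → Subset N
below u x = tabulate λ y → does (u y <? u x)

∈-below⁺ : (u : Fin N → ℕ) {x y : Fin N} → u y < u x → y ∈ below u x
∈-below⁺ u {x} {y} uy<ux = lookup⇒[]= y _ (trans (lookup∘tabulate _ y) (dec-true (u y <? u x) uy<ux))

∈-below⁻ : (u : Fin N → ℕ) {x y : Fin N} → y ∈ below u x → u y < u x
∈-below⁻ u {x} {y} y∈ = <ᵇ⇒< _ _
  (Equivalence.from T-≡ (trans (sym (lookup∘tabulate _ y)) ([]=⇒lookup y∈)))

-- Positions are counted rather than values: tied positions share a rank, and the ranks occupied by
-- a tie are skipped afterwards.
rank : (Fin N → ℕ) → Fin N → ℕ
rank u x = ∣ below u x ∣

rank-⊆ : (u v : Fin N → ℕ) {x y : Fin N} → (∀ z → u z < u x → v z < v y) → rank u x ≤ rank v y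
rank-⊆ u v u⊆v = p⊆q⇒∣p∣≤∣q∣ λ z∈ → ∈-below⁺ v (u⊆v _ (∈-below⁻ u z∈))

rank-< : (u : Fin N → ℕ) {x y : Fin N} → u x < u y → rank u x < rank u y
rank-< u {x} ux<uy = p⊂q⇒∣p∣<∣q∣
  ( (λ z∈ → ∈-below⁺ u (<-trans (∈-below⁻ u z∈) ux<uy))
  , x , ∈-below⁺ u ux<uy , λ x∈ → <-irrefl refl (∈-below⁻ u x∈) )

rank-cancel-≤ : (u : Fin N → ℕ) {x y : Fin N} → rank u x ≤ rank u y → u x ≤ u y
rank-cancel-≤ u r≤ = ≮⇒≥ λ uy<ux → <⇒≱ (rank-< u uy<ux) r≤

rank<N : (u : Fin N → ℕ) (x : Fin N) → rank u x < N
rank<N u x = subst (rank u x <_) (∣⊤∣≡n _) (p⊂q⇒∣p∣<∣q∣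
  ((λ _ → ∈⊤) , x , ∈⊤ , λ x∈ → <-irrefl refl (∈-below⁻ u x∈)))

ranks : (Fin N → ℕ) → Fin N → Fin N
ranks u x = fromℕ< (rank<N u x)

-- Punching a missed value out of the codomain would leave an injection from `Fin (suc n)` into
-- `Fin n`.
injective⇒strictlySurjective : {f : Fin n → Fin n} → Injective _≡_ _≡_ f → StrictlySurjective _≡_ f
injective⇒strictlySurjective {zero}  f-inj ()
injective⇒strictlySurjective {suc n} {f} f-inj y with Fin.any? (λ x → f x Fin.≟ y)
... | yes hit = hit
... | no  ¬hit = contradiction (Fin.injective⇒≤ g-inj) 1+n≰n
  where
  y≢f : ∀ x → y ≢ f x
  y≢f x y≡fx = ¬hit (x , sym y≡fx)
  g-inj : Injective _≡_ _≡_ (λ x → Fin.punchOut (y≢f x))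
  g-inj = f-inj ∘ Fin.punchOut-injective (y≢f _) (y≢f _)

-- For injective `u` the ranks are distinct, hence a permutation of `Fin n`; `π` is its inverse.
sorting : {u : Fin n → ℕ} → Injective _≡_ _≡_ u → ∃ λ (π : Fin n → Fin n) →
          (∀ {i j} → i Fin.< j → u (π i) < u (π j)) × StrictlySurjective _≡_ π
sorting {u = u} u-inj = π , π-mono , λ x → ranks u x , ranks-injective (proj₂ (surj (ranks u x)))
  where
  toℕ-ranks : ∀ x → toℕ (ranks u x) ≡ rank u x
  toℕ-ranks x = Fin.toℕ-fromℕ< (rank<N u x)

  ranks-injective : Injective _≡_ _≡_ (ranks u)
  ranks-injective {x} {y} eq = u-inj (≤-antisym (rank-cancel-≤ u (≤-reflexive rx≡ry))
                                                (rank-cancel-≤ u (≤-reflexive (sym rx≡ry))))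
    where rx≡ry = trans (sym (toℕ-ranks x)) (trans (cong toℕ eq) (toℕ-ranks y))

  surj : StrictlySurjective _≡_ (ranks u)
  surj = injective⇒strictlySurjective ranks-injective

  π : _ → _
  π = proj₁ ∘ surj

  rank-π : ∀ i → rank u (π i) ≡ toℕ i
  rank-π i = trans (sym (toℕ-ranks (π i))) (cong toℕ (proj₂ (surj i)))

  π-mono : ∀ {i j} → i Fin.< j → u (π i) < u (π j)
  π-mono {i} {j} i<j = ≰⇒> λ uj≤ui →
    <⇒≱ i<j (subst₂ _≤_ (rank-π j) (rank-π i)
                    (rank-⊆ u u λ z uz<uj → <-≤-trans uz<uj uj≤ui))

-- The factor leaves room for the ranks strictly between two consecutive values, so
-- that the values of u extend to a strictly increasing function of all ranks.
spread : ℕ → ℕ → ℕ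
spread N m = suc N * suc m

spread-mono : ∀ N → StrictlyMonotone (spread N)
spread-mono N m<n = *-monoʳ-< (suc N) (s<s m<n)

module Interpolation (u : Fin N → ℕ) where

  excess : Fin N → ℕ
  excess x = spread N (u x) ∸ rank u x

  rank≤spread : ∀ x → rank u x ≤ spread N (u x)
  rank≤spread x = ≤-trans (<⇒≤ (m≤n⇒m≤1+n (rank<N u x))) (m≤m*n (suc N) (suc (u x)))

  -- If `u` grows, `spread N` grows by at least `suc N`, which outweighs any rank. Ties have equal
  -- ranks, and a decrease of `u` would contradict the order of the ranks.
  excess-mono : ∀ {x y} → rank u x ≤ rank u y → excess x ≤ excess y
  excess-mono {x} {y} rx≤ry with <-cmp (u x) (u y)
  ... | tri< ux<uy _ _ = begin
    excess x                       ≤⟨ m∸n≤m (spread N (u x)) (rank u x) ⟩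
    spread N (u x)                 ≡⟨ m+n∸m≡n (suc N) (spread N (u x)) ⟨
    suc N + spread N (u x) ∸ suc N ≡⟨ cong (_∸ suc N) (*-suc (suc N) (suc (u x))) ⟨
    spread N (suc (u x)) ∸ suc N   ≤⟨ ∸-mono (*-monoʳ-≤ (suc N) (s≤s ux<uy)) (<⇒≤ (m≤n⇒m≤1+n (rank<N u y))) ⟩
    excess y                       ∎
    where open ≤-Reasoning
  ... | tri≈ _ ux≡uy _ = ∸-mono (≤-reflexive (cong (spread N) ux≡uy))
                                (rank-⊆ u u λ z → subst (u z <_) (sym ux≡uy))
  ... | tri> _ _ uy<ux = contradiction (rank-cancel-≤ u rx≤ry) (<⇒≱ uy<ux)

  -- The value 0 is neutral for `sup`, so positions of rank above `t` are ignored.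
  excessAt : ℕ → Fin N → ℕ
  excessAt t x = if does (rank u x ≤? t) then excess x else 0

  excessAt-yes : ∀ {t x} → rank u x ≤ t → excessAt t x ≡ excess x
  excessAt-yes {t} {x} r≤t rewrite dec-true (rank u x ≤? t) r≤t = refl

  excessAt-no : ∀ {t x} → ¬ rank u x ≤ t → excessAt t x ≡ 0
  excessAt-no {t} {x} r≰t rewrite dec-false (rank u x ≤? t) r≰t = refl

  excessAt-mono : ∀ {s t} → s ≤ t → ∀ x → excessAt s x ≤ excessAt t x
  excessAt-mono {s} {t} s≤t x with rank u x ≤? s
  ... | yes r≤s = ≤-reflexive (trans (excessAt-yes r≤s) (sym (excessAt-yes (≤-trans r≤s s≤t))))
  ... | no  r≰s = subst (_≤ excessAt t x) (sym (excessAt-no r≰s)) z≤n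

  -- The identity plus a weakly increasing correction, so strictly increasing. The correction is the
  -- largest excess among the ranks reached so far, which also settles the skipped ranks.
  interpolate : ℕ → ℕ
  interpolate t = t + sup (excessAt t)

  interpolate-mono : StrictlyMonotone interpolate
  interpolate-mono s<t = +-mono-<-≤ s<t
    (sup-least _ λ x → ≤-trans (excessAt-mono (<⇒≤ s<t) x) (≤sup _ x))

  -- By `excess-mono`, the supremum at the rank of `x` is attained at `x` itself.
  interpolate-rank : ∀ x → interpolate (rank u x) ≡ spread N (u x)
  interpolate-rank x = trans (cong (rank u x +_) sup≡excess) (m+[n∸m]≡n (rank≤spread x))
    where
    upper : ∀ y → excessAt (rank u x) y ≤ excess x
    upper y with rank u y ≤? rank u x
    ... | yes r≤ = subst (_≤ excess x) (sym (excessAt-yes r≤)) (excess-mono r≤)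
    ... | no  r≰ = subst (_≤ excess x) (sym (excessAt-no r≰)) z≤n
    sup≡excess : sup (excessAt (rank u x)) ≡ excess x
    sup≡excess = ≤-antisym (sup-least _ upper)
      (subst (_≤ sup (excessAt (rank u x))) (excessAt-yes ≤-refl) (≤sup (excessAt (rank u x)) x))

_≈ₒ_ : (u v : Vec ℕ N) → Set
u ≈ₒ v = ∀ x y → lookup u x ≤ lookup u y ⇔ lookup v x ≤ lookup v y

module TupleRamsey (em : ExcludedMiddle 0ℓ) where
  open Ramsey em

  -- An N-tuple is an increasing N-tuple reindexed by its ranks, and order
  -- equivalent tuples have the same ranks.
  ramsey-tuples : (as : List A) (χ : A → Vec ℕ N → Fin c) → ∃ λ h → StrictlyMonotone h ×
    (∀ {a} → a List.∈ as → ∀ u v → u ≈ₒ v → χ a (Vec.map h u) ≡ χ a (Vec.map h v))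
  ramsey-tuples {A} {N} {c} as χ = h ∘ spread N , h-mono ∘ spread-mono N , λ a∈ u v u≈v →
    trans (colour a∈ u) (trans (cong (colourOf a∈) (ranks-cong u v u≈v)) (sym (colour a∈ v)))
    where
    -- There are only finitely many ranking vectors, so pairing them with `as` gives a finite family
    -- of colorings of increasing tuples.
    rankings = vectors (allFin N) N

    reindexed : A × Vec (Fin N) N → Vec ℕ N → Fin c
    reindexed (a , ρ) w = χ a (Vec.map (lookup w) ρ)

    fam = ramsey-family (cartesianProduct as rankings) reindexed
    h = proj₁ fam
    h-mono : StrictlyMonotone h
    h-mono = proj₁ (proj₂ fam)

    pair∈ : ∀ {a} → a List.∈ as → ∀ ρ → (a , ρ) List.∈ cartesianProduct as rankings
    pair∈ a∈ ρ = ∈-cartesianProduct⁺ a∈ (∈-vectors ρ λ i → ∈-allFin (lookup ρ i))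

    colourOf : ∀ {a} → a List.∈ as → Vec (Fin N) N → Fin c
    colourOf a∈ ρ = proj₁ (proj₂ (proj₂ fam) (pair∈ a∈ ρ))

    rankVec : Vec ℕ N → Vec (Fin N) N
    rankVec u = tabulate (ranks (lookup u))

    colour : ∀ {a} (a∈ : a List.∈ as) u → χ a (Vec.map (h ∘ spread N) u) ≡ colourOf a∈ (rankVec u)
    colour {a} a∈ u = trans (cong (χ a) (sym reindex))
      (proj₂ (proj₂ (proj₂ fam) (pair∈ a∈ (rankVec u))) {w}
        (tabulate-linked (interpolate ∘ toℕ) (λ i<j → interpolate-mono i<j)))
      where
      open Interpolation (lookup u)
      -- An increasing vector whose entry at the rank of each `x` is `spread N (lookup u x)`, so
      -- reindexing it by the ranks recovers the spread tuple.
      w = tabulate (interpolate ∘ toℕ)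
      pointwise : ∀ x → lookup (Vec.map h w) (ranks (lookup u) x) ≡ h (spread N (lookup u x))
      pointwise x = begin
        lookup (Vec.map h w) (ranks (lookup u) x)       ≡⟨ lookup-map _ h w ⟩
        h (lookup w (ranks (lookup u) x))               ≡⟨ cong h (lookup∘tabulate _ (ranks (lookup u) x)) ⟩
        h (interpolate (toℕ (ranks (lookup u) x)))      ≡⟨ cong (h ∘ interpolate) (Fin.toℕ-fromℕ< _) ⟩
        h (interpolate (rank (lookup u) x))             ≡⟨ cong h (interpolate-rank x) ⟩
        h (spread N (lookup u x))                       ∎
        where open ≡-Reasoning
      reindex : Vec.map (lookup (Vec.map h w)) (rankVec u) ≡ Vec.map (h ∘ spread N) u
      reindex = begin
        Vec.map (lookup (Vec.map h w)) (rankVec u)            ≡⟨ tabulate-∘ _ _ ⟨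
        tabulate (lookup (Vec.map h w) ∘ ranks (lookup u))    ≡⟨ tabulate-cong pointwise ⟩
        tabulate (h ∘ spread N ∘ lookup u)                    ≡⟨ tabulate-∘ _ _ ⟩
        Vec.map (h ∘ spread N) (tabulate (lookup u))          ≡⟨ cong (Vec.map _) (tabulate∘lookup u) ⟩
        Vec.map (h ∘ spread N) u                              ∎
        where open ≡-Reasoning

    ranks-cong : ∀ u v → u ≈ₒ v → rankVec u ≡ rankVec v
    ranks-cong u v u≈v = tabulate-cong λ x → Fin.fromℕ<-cong _ _ (≤-antisym
      (rank-⊆ (lookup u) (lookup v) λ z u< → ≰⇒> λ v≤ → <⇒≱ u< (Equivalence.from (u≈v x z) v≤))
      (rank-⊆ (lookup v) (lookup u) λ z v< → ≰⇒> λ u≤ → <⇒≱ v< (Equivalence.to (u≈v x z) u≤)))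
      (rank<N (lookup u) x) (rank<N (lookup v) x)

-- Finite subsets and strictly increasing enumerations

opposite-< : {i j : Fin n} → i Fin.< j → opposite j Fin.< opposite i
opposite-< {n} {i} {j} i<j
  rewrite Fin.opposite-prop i | Fin.opposite-prop j = ∸-monoʳ-< (s≤s i<j) (Fin.toℕ<n j)

does⁻ : (A? : Dec A) → does A? ≡ true → A
does⁻ (yes a) _ = a

∣⁅x⁆∪p∣≤1+∣p∣ : (x : Fin n) (p : Subset n) → ∣ ⁅ x ⁆ ∪ p ∣ ≤ suc ∣ p ∣
∣⁅x⁆∪p∣≤1+∣p∣ zero    (s ∷ p)     =
  s≤s (≤-trans (≤-reflexive (cong ∣_∣ (∪-identityˡ p))) (∣p∣≤∣x∷p∣ s p))
∣⁅x⁆∪p∣≤1+∣p∣ (suc x) (true  ∷ p) = s≤s (∣⁅x⁆∪p∣≤1+∣p∣ x p)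
∣⁅x⁆∪p∣≤1+∣p∣ (suc x) (false ∷ p) = ∣⁅x⁆∪p∣≤1+∣p∣ x p

-- The subset lies in a union of singletons, one for each entry of the list, and each singleton adds
-- at most one element.
covered⇒∣p∣≤length : (f : A → Fin c) (as : List A) (p : Subset c) →
                     (∀ {r} → r ∈ p → ∃ λ a → a List.∈ as × f a ≡ r) → ∣ p ∣ ≤ length as
covered⇒∣p∣≤length {c = c} f as p covered =
  ≤-trans (p⊆q⇒∣p∣≤∣q∣ λ r∈p → let a , a∈as , fa≡r = covered r∈p in
             subst (_∈ cover as) fa≡r (∈-cover a∈as))
          (∣cover∣≤ as)
  where
  cover : List _ → Subset c
  cover []       = ⊥
  cover (a ∷ as) = ⁅ f a ⁆ ∪ cover as

  ∈-cover : ∀ {a as} → a List.∈ as → f a ∈ cover as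
  ∈-cover (here refl) = x∈p∪q⁺ (inj₁ (x∈⁅x⁆ _))
  ∈-cover (there a∈)  = x∈p∪q⁺ (inj₂ (∈-cover a∈))

  ∣cover∣≤ : ∀ as → ∣ cover as ∣ ≤ length as
  ∣cover∣≤ []       = ≤-reflexive (∣⊥∣≡0 c)
  ∣cover∣≤ (a ∷ as) = ≤-trans (∣⁅x⁆∪p∣≤1+∣p∣ (f a) (cover as)) (s≤s (∣cover∣≤ as))

-- Each head is the least element of its vector. If the heads differed, each would lie strictly
-- below the other; once they agree, no later entry equals them and induction applies to the tails.
linked-unique : {R : Rel A 0ℓ} → Irreflexive _≡_ R → Transitive R → {xs ys : Vec A n} →
                Linked R xs → Linked R ys → (∀ {z} → z ∈ᵥ xs → z ∈ᵥ ys) →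
                (∀ {z} → z ∈ᵥ ys → z ∈ᵥ xs) → xs ≡ ys
linked-unique irr tr {[]} {[]} _ _ _ _ = refl
linked-unique {R = R} irr tr {x ∷ xs} {y ∷ ys} lx ly xs⊆ys ys⊆xs = cong₂ _∷_ x≡y
  (linked-unique irr tr (Linked.tail lx) (Linked.tail ly)
    (λ z∈ → shrink (irr x≡y) (minimum lx z∈) (xs⊆ys (there z∈)))
    (λ z∈ → shrink (irr (sym x≡y)) (minimum ly z∈) (ys⊆xs (there z∈))))
  where
  minimum : ∀ {x z n} {xs : Vec _ n} → Linked R (x ∷ xs) → z ∈ᵥ xs → R x z
  minimum {xs = _ ∷ _} (Rxx′ ∷ l) z∈ = All.lookup (Linked.Linked⇒All tr Rxx′ l) z∈
  x≡y : x ≡ y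
  x≡y with xs⊆ys (here refl) | ys⊆xs (here refl)
  ... | here x≡y | _        = x≡y
  ... | there _  | here y≡x = sym y≡x
  ... | there x∈ | there y∈ = contradiction (tr (minimum lx y∈) (minimum ly x∈)) (irr refl)
  shrink : ∀ {x y z n} {ys : Vec _ n} → ¬ R x y → R x z → z ∈ᵥ y ∷ ys → z ∈ᵥ ys
  shrink ¬Rxy Rxz (here refl) = contradiction Rxz ¬Rxy
  shrink ¬Rxy Rxz (there z∈)  = z∈

-- Numbering the forest

-- pair c a = 2^c (2a + 1) is the number of the a-th child of node c; the roots are
-- the children of 0, which is not itself a node.
pair : ℕ → ℕ → ℕ
pair zero    a = suc (2 * a)
pair (suc c) a = 2 * pair c a

-- The exponent of 2 in the number gives the parent: parity separates zero from successor, and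
-- halving reduces to the predecessor.
pair-injective : ∀ c c′ {a a′} → pair c a ≡ pair c′ a′ → c ≡ c′ × a ≡ a′
pair-injective zero    zero     eq = refl , *-cancelˡ-≡ _ _ 2 (suc-injective eq)
pair-injective zero    (suc c′) {a} eq = contradiction (sym eq) (even≢odd (pair c′ _) a)
pair-injective (suc c) zero     {a} {a′} eq = contradiction eq (even≢odd (pair c _) a′)
pair-injective (suc c) (suc c′) eq =
  Product.map₁ (cong suc) (pair-injective c c′ (*-cancelˡ-≡ _ _ 2 eq))

pair-monoʳ : ∀ c → StrictlyMonotone (pair c)
pair-monoʳ zero    a<a′ = s<s (*-monoʳ-< 2 a<a′)
pair-monoʳ (suc c) a<a′ = *-monoʳ-< 2 (pair-monoʳ c a<a′)

<pair : ∀ c a → c < pair c a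
<pair zero    a = z<s
<pair (suc c) a = begin-strict
  suc c              ≡⟨ +-comm 1 c ⟩
  c + 1              <⟨ +-mono-<-≤ (<pair c a) (≤-trans (≤-<-trans z≤n (<pair c a)) (m≤m+n _ 0)) ⟩
  pair (suc c) a     ∎
  where open ≤-Reasoning

open StrictTotalOrder using (Carrier)

-- The node numbers along the branch `x` below node `c`, from the top down, with `c` itself left
-- out.
codes : ∀ d → ℕ → Carrier (ω^ d) → Vec ℕ d
codes zero    c x       = []
codes (suc d) c (a , x) = pair c a ∷ codes d (pair c a) x

leaf : ∀ d → ℕ → Carrier (ω^ d) → ℕ
leaf zero    c _       = c
leaf (suc d) c (a , x) = leaf d (pair c a) x

build : Vec ℕ d → Carrier (ω^ d)
build []      = zero
build (a ∷ v) = a , build v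

ω^-≈⇒≡ : ∀ d {x y} → StrictTotalOrder._≈_ (ω^ d) x y → x ≡ y
ω^-≈⇒≡ zero    x≈y         = x≈y
ω^-≈⇒≡ (suc d) (a≡ , x≈y) = cong₂ _,_ a≡ (ω^-≈⇒≡ d x≈y)

-- Where two branches first part their nodes are siblings, and numbers increase from left to right
-- among siblings.
build-codes-mono : ∀ {h} → StrictlyMonotone h → ∀ d c {x y} → StrictTotalOrder._<_ (ω^ d) x y →
  StrictTotalOrder._<_ (ω^ d) (build (Vec.map h (codes d c x))) (build (Vec.map h (codes d c y)))
build-codes-mono h-mono zero    c {zero} {zero} ()
build-codes-mono h-mono (suc d) c (inj₁ a<a′)         = inj₁ (h-mono (pair-monoʳ c a<a′))
build-codes-mono h-mono (suc d) c (inj₂ (refl , x<y)) =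
  inj₂ (refl , build-codes-mono h-mono d _ x<y)

-- A number determines its parent and its place among the siblings, so climbing from the leaf
-- recovers the branch and its starting node.
leaf-injective : ∀ d {c c′} {x x′ : Carrier (ω^ d)} → leaf d c x ≡ leaf d c′ x′ → c ≡ c′ × x ≡ x′
leaf-injective zero {x = zero} {zero} eq = eq , refl
leaf-injective (suc d) eq =
  let eq′ , x≡x′ = leaf-injective d eq
      c≡c′ , a≡a′ = pair-injective _ _ eq′
  in c≡c′ , cong₂ _,_ a≡a′ x≡x′

lookup-leaf : ∀ d c x → lookup (c ∷ codes d c x) (fromℕ d) ≡ leaf d c x
lookup-leaf zero    c x       = refl
lookup-leaf (suc d) c (a , x) = lookup-leaf d (pair c a) x

codes-parent : ∀ d {c c′} x x′ l → lookup (codes d c x) l ≡ lookup (codes d c′ x′) l → c ≡ c′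
codes-parent (suc d) (a , x) (a′ , x′) zero    eq = proj₁ (pair-injective _ _ eq)
codes-parent (suc d) (a , x) (a′ , x′) (suc l) eq = proj₁ (pair-injective _ _ (codes-parent d x x′ l eq))

-- Equal nodes have equal parents, so a tie between two branches persists at every shallower depth.
codes-prefix : ∀ d {c c′} x x′ {l l′} → l′ Fin.≤ l →
  lookup (codes d c x) l ≡ lookup (codes d c′ x′) l → lookup (codes d c x) l′ ≡ lookup (codes d c′ x′) l′
codes-prefix (suc d) x x′ {zero}  {zero}   _    eq = eq
codes-prefix (suc d) (a , x) (a′ , x′) {suc l} {zero}   _    eq = codes-parent d x x′ l eq
codes-prefix (suc d) (a , x) (a′ , x′) {suc l} {suc l′} l′≤l eq = codes-prefix d x x′ (s≤s⁻¹ l′≤l) eq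

codes-increasing : ∀ d c x → Increasing (c ∷ codes d c x)
codes-increasing zero    c x       = [-]
codes-increasing (suc d) c (a , x) = <pair c a ∷ codes-increasing d (pair c a) x

data Depth : ℕ → ℕ → Set where
  root  : ∀ b → Depth 0 (pair 0 b)
  child : ∀ {m c} a → Depth m c → Depth (suc m) (pair c a)

depth-positive : Depth m c → 0 < c
depth-positive (root b)          = z<s
depth-positive (child {c = c} a D) = ≤-<-trans z≤n (<pair c a)

-- Climb both parent chains in parallel. They end together, since the parent of a root is 0 whereas
-- the parent of any other node is positive.
depth-unique : ∀ {c c′ m m′} → Depth m c → Depth m′ c′ → c ≡ c′ → m ≡ m′
depth-unique (root b)    (root b′)    eq = refl
depth-unique (root b)    (child {c = c} a D) eq =
  contradiction (proj₁ (pair-injective 0 c {b} {a} eq)) (<⇒≢ (depth-positive D))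
depth-unique (child {c = c} a D) (root b) eq =
  contradiction (sym (proj₁ (pair-injective c 0 {a} {b} eq))) (<⇒≢ (depth-positive D))
depth-unique (child {c = c} a D) (child {c = c′} a′ D′) eq =
  cong suc (depth-unique D D′ (proj₁ (pair-injective c c′ eq)))

depth-codes : ∀ d {c m} x (l : Fin d) → Depth m c → Depth (suc (toℕ l + m)) (lookup (codes d c x) l)
depth-codes (suc d) (a , x) zero    D = child a D
depth-codes (suc d) {c} {m} (a , x) (suc l) D =
  subst (λ m → Depth (suc m) (lookup (codes d (pair c a) x) l)) (+-suc (toℕ l) m) (depth-codes d x l (child a D))

-- Self-embeddings of ω^d · k

module Ordinal (d k : ℕ) where
  S : Order
  S = ω^ d · fin k
  module S = StrictTotalOrder S
  open S public using () renaming (Carrier to ∣S∣)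

  S-≈⇒≡ : ∀ {s t} → s S.≈ t → s ≡ t
  S-≈⇒≡ (b≡ , x≈) = cong₂ _,_ b≡ (ω^-≈⇒≡ d x≈)

  code : ∣S∣ → Vec ℕ d
  code (b , x) = codes d (pair 0 (toℕ b)) x

  -- Numbers the coefficient of ω^0 if d ≥ 1 but the block if d = 0, so that increasing
  -- keys give both cond₁ and cond₁′.
  key : ∣S∣ → ℕ
  key (b , x) = leaf d (pair 0 (toℕ b)) x

  key-injective : Injective _≡_ _≡_ key
  key-injective eq = let c≡c′ , x≡x′ = leaf-injective d eq in
    cong₂ _,_ (Fin.toℕ-injective (proj₂ (pair-injective 0 0 c≡c′))) x≡x′

  module Embedding {h : ℕ → ℕ} (h-mono : StrictlyMonotone h) where

    emb : ∣S∣ → ∣S∣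
    emb s = proj₁ s , build (Vec.map h (code s))

    emb-mono : ∀ {s t} → s S.< t → emb s S.< emb t
    emb-mono (inj₁ b<b′)         = inj₁ b<b′
    emb-mono (inj₂ (refl , x<y)) = inj₂ (refl , build-codes-mono h-mono d _ x<y)

    emb-cancel : ∀ {s t} → emb s S.< emb t → s S.< t
    emb-cancel {s} {t} es<et with S.compare s t
    ... | tri< s<t _ _ = s<t
    ... | tri≈ _ s≈t _ rewrite S-≈⇒≡ s≈t = contradiction es<et (S.irrefl S.Eq.refl)
    ... | tri> _ _ t<s = contradiction es<et (S.asym (emb-mono t<s))

    emb-injective : Injective _≡_ _≡_ emb
    emb-injective {s} {t} es≡et with S.compare s t
    ... | tri< s<t _ _ = contradiction (emb-mono s<t) (S.irrefl (S.Eq.reflexive es≡et))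
    ... | tri≈ _ s≈t _ = S-≈⇒≡ s≈t
    ... | tri> _ _ t<s = contradiction (emb-mono t<s) (S.irrefl (S.Eq.reflexive (sym es≡et)))

    module Image (em : ExcludedMiddle 0ℓ) where
      range : SubsetOf S
      range = record
        { to   = λ s → does (em {∃ λ t → emb t ≡ s})
        ; cong = λ s≈t → cong (λ s → does (em {∃ λ t → emb t ≡ s})) (S-≈⇒≡ s≈t)
        }

      preimage : ∀ {s} → Members S range s → ∃ λ t → emb t ≡ s
      preimage = does⁻ em

      -- The isomorphism is the inverse of `emb`, which reflects the order because it strictly
      -- preserves a total one.
      range≃ : (S ↾ range) ≃ₒ S
      range≃ = (λ s → proj₁ (preimage (proj₂ s))) , record
        { isOrderMonomorphism = record
          { isOrderHomomorphism = record
            { cong = λ {s} {t} s≈t → S.Eq.reflexive (emb-injective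
                (trans (eq s) (trans (S-≈⇒≡ s≈t) (sym (eq t)))))
            ; mono = λ {s} {t} s<t → emb-cancel (subst₂ S._<_ (sym (eq s)) (sym (eq t)) s<t)
            }
          ; injective = λ {s} {t} s≈t → S.Eq.reflexive
              (trans (sym (eq s)) (trans (cong emb (S-≈⇒≡ s≈t)) (eq t)))
          ; cancel = λ {s} {t} s<t → subst₂ S._<_ (eq s) (eq t) (emb-mono s<t)
          }
        ; surjective = λ t → (emb t , dec-true em (t , refl)) , λ {s} s≈t →
            S.Eq.reflexive (emb-injective (trans (eq s) (S-≈⇒≡ s≈t)))
        }
        where
        eq : (s : ∃ (Members S range)) → emb (proj₁ (preimage (proj₂ s))) ≡ proj₁ s
        eq s = proj₂ (preimage (proj₂ s))

  -- The coloring rule of a finite family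

  module Rule {n : ℕ} (y : Fin n → ∣S∣) where

    -- code is indexed by the depth below the root, coloring rules by the exponent.
    val : Fin n × Fin d → ℕ
    val (i , j) = lookup (code (y i)) (opposite j)

    blocks : Vec (Fin k) n
    blocks = tabulate (proj₁ ∘ y)

    table : Table n d
    table = tabulate λ i → tabulate λ j → row (i , j)
      where
      row : Fin n × Fin d → Vec (Vec Bool d) n
      row p = tabulate λ i′ → tabulate λ j′ → does (val p ≤? val (i′ , j′))

    -- A relation between a family and a candidate, so that two families with the same rule can be
    -- compared.
    Realises : Candidate n d k → Set
    Realises (Y , R) = (∀ i → lookup Y i ≡ proj₁ (y i)) × (∀ p q → ⟦ R ⟧ p q ⇔ val p ≤ val q)

    realises : Realises (blocks , table)
    realises = lookup∘tabulate _ , λ p q → let eq = lookup-table p q in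
      mk⇔ (λ Rpq → ≤ᵇ⇒≤ _ _ (Equivalence.from T-≡ (trans (sym eq) Rpq)))
          (λ p≤q → trans eq (dec-true (_ ≤? _) p≤q))
      where
      lookup-table : ∀ (p@(i , j) q@(i′ , j′) : Fin n × Fin d) →
        lookup (lookup (lookup (lookup table i) j) i′) j′ ≡ does (val p ≤? val q)
      lookup-table p@(i , j) (i′ , j′) = begin
        lookup (lookup (lookup (lookup table i) j) i′) j′
          ≡⟨ cong (λ R → lookup (lookup (lookup R j) i′) j′) (lookup∘tabulate _ i) ⟩
        _ ≡⟨ cong (λ R → lookup (lookup R i′) j′) (lookup∘tabulate _ j) ⟩
        _ ≡⟨ cong (λ R → lookup R j′) (lookup∘tabulate _ i′) ⟩
        _ ≡⟨ lookup∘tabulate _ j′ ⟩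
        does (val p ≤? val (i′ , j′)) ∎
        where open ≡-Reasoning

    val-key : ∀ i (j : Fin d) → toℕ j ≡ 0 → val (i , j) ≡ key (y i)
    val-key i j j≡0 = go d (proj₂ (y i)) j j≡0
      where
      go : ∀ d {c} x (j : Fin d) → toℕ j ≡ 0 → lookup (codes d c x) (opposite j) ≡ leaf d c x
      go (suc d) (a , x) zero _ = lookup-leaf d _ x

    val-level : ∀ p q → val p ≡ val q → proj₂ p ≡ proj₂ q
    val-level (i , j) (i′ , j′) eq = begin
      j                      ≡⟨ Fin.opposite-involutive j ⟨
      opposite (opposite j)  ≡⟨ cong opposite (Fin.toℕ-injective (+-cancelʳ-≡ 0 _ _ (suc-injective depths≡))) ⟩
      opposite (opposite j′) ≡⟨ Fin.opposite-involutive j′ ⟩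
      j′                     ∎
      where
      open ≡-Reasoning
      depth : ∀ i j → Depth (suc (toℕ (opposite j) + 0)) (val (i , j))
      depth i j = depth-codes d (proj₂ (y i)) (opposite j) (root (toℕ (proj₁ (y i))))
      depths≡ : suc (toℕ (opposite j) + 0) ≡ suc (toℕ (opposite j′) + 0)
      depths≡ = depth-unique (depth i j) (depth i′ j′) eq

    val-< : ∀ i {j j′} → j′ Fin.< j → val (i , j) < val (i , j′)
    val-< i j′<j = Linked.lookup⁺ <-trans (codes-increasing d _ (proj₂ (y i))) (s<s (opposite-< j′<j))

    -- Comparing node numbers gives a total preorder. `cond₁` and `cond₁′` come from increasing
    -- keys, `cond₃` from numbers growing from parent to child, `cond₄` from a number determining
    -- its depth, `cond₂` and `cond₅` from its determining its parent.
    isCR : (∀ {i i′} → i Fin.< i′ → key (y i) < key (y i′)) →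
           ∀ σ → Realises σ → CR n d k σ
    isCR key-mono (Y , R) (Y≡ , R⇔) = record
      { isTotalPreorder = record
        { isPreorder = record
          { isEquivalence = isEquivalence
          ; reflexive     = λ where refl → from ≤-refl
          ; trans         = λ p q → from (≤-trans (to p) (to q))
          }
        ; total = λ p q → Sum.map from from (≤-total (val p) (val q))
        }
      ; cond₁ = λ i i′ j j≡0 i<i′ → strict
          (subst₂ _<_ (sym (val-key i j j≡0)) (sym (val-key i′ j j≡0)) (key-mono i<i′))
      ; cond₁′ = λ d≡0 i i′ i<i′ → subst₂ Fin._<_ (sym (Y≡ i)) (sym (Y≡ i′))
          (block-mono d≡0 (key-mono i<i′))
      ; cond₂ = λ i i′ j i∼i′ → trans (Y≡ i) (trans
          (Fin.toℕ-injective (proj₂ (pair-injective 0 0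
            (codes-parent d (proj₂ (y i)) (proj₂ (y i′)) (opposite j) (tied i∼i′)))))
          (sym (Y≡ i′)))
      ; cond₃ = λ i j j′ j′<j → strict (val-< i j′<j)
      ; cond₄ = λ i i′ j j′ i∼i′ → val-level (i , j) (i′ , j′) (tied i∼i′)
      -- By contraposition: exponent `j` lies one depth above `j⁻`, so a tie at `j⁻` passes up to
      -- `j`.
      ; cond₅ = λ i i′ j j⁻ j≡ i≁i′ i∼i′ → i≁i′ (untied
          (codes-prefix d (proj₂ (y i)) (proj₂ (y i′)) 
            (<⇒≤ (opposite-< (≤-reflexive (sym j≡)))) (tied i∼i′)))
      }
      where
      to : ∀ {p q} → ⟦ R ⟧ p q → val p ≤ val q
      to {p} {q} = Equivalence.to (R⇔ p q)
      from : ∀ {p q} → val p ≤ val q → ⟦ R ⟧ p q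
      from {p} {q} = Equivalence.from (R⇔ p q)
      strict : ∀ {p q} → val p < val q → ⟦ R ⟧ p q × ¬ ⟦ R ⟧ q p
      strict p<q = from (<⇒≤ p<q) , λ q≼p → <⇒≱ p<q (to q≼p)
      tied : ∀ {p q} → ⟦ R ⟧ p q × ⟦ R ⟧ q p → val p ≡ val q
      tied (p≼q , q≼p) = ≤-antisym (to p≼q) (to q≼p)
      untied : ∀ {p q} → val p ≡ val q → ⟦ R ⟧ p q × ⟦ R ⟧ q p
      untied eq = from (≤-reflexive eq) , from (≤-reflexive (sym eq))
      block-mono : d ≡ 0 → ∀ {s t} → key s < key t → proj₁ s Fin.< proj₁ t
      -- For `d ≡ 0` the key of an element of block b is `pair 0 b`, that is 2b + 1.
      block-mono refl s<t = *-cancelˡ-< 2 _ _ (s<s⁻¹ s<t)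

    tuple : Vec ℕ (n * d)
    tuple = concat (tabulate (code ∘ y))

    lookup-tuple : ∀ i l → lookup tuple (combine i l) ≡ lookup (code (y i)) l
    lookup-tuple i l = trans (lookup-concat (tabulate (code ∘ y)) i l)
                             (cong (λ v → lookup v l) (lookup∘tabulate _ i))

    val-tuple : ∀ i l → lookup tuple (combine i l) ≡ val (i , opposite l)
    val-tuple i l = trans (lookup-tuple i l)
                          (cong (lookup (code (y i))) (sym (Fin.opposite-involutive l)))

  open Rule

  realises⇒≈ₒ : ∀ {n} σ (y y′ : Fin n → ∣S∣) → Realises y σ → Realises y′ σ → tuple y ≈ₒ tuple y′
  realises⇒≈ₒ {n} _ y y′ (_ , R⇔) (_ , R⇔′) s t
    with i  , l  , refl ← Fin.combine-surjective {n} {d} s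
       | i′ , l′ , refl ← Fin.combine-surjective {n} {d} t
    rewrite val-tuple y i l | val-tuple y i′ l′ | val-tuple y′ i l | val-tuple y′ i′ l′
    = ⇔.trans (⇔.sym (R⇔ _ _)) (R⇔′ _ _)

-- Undoes the concatenation in `tuple`.
rows : Vec ℕ (n * d) → Fin n → Vec ℕ d
rows u i = tabulate λ l → lookup u (combine i l)

∈-candidates : (σ : Candidate n d k) → σ List.∈ candidates n d k
∈-candidates (Y , R) = ∈-cartesianProduct⁺ (∈-vectors Y λ i → ∈-allFin _)
  (∈-vectors R λ _ → ∈-vectors _ λ _ → ∈-vectors _ λ _ → ∈-vectors _ λ _ → ∈-bools _)
  where
  ∈-bools : ∀ b → b List.∈ false ∷ true ∷ []
  ∈-bools false = here refl
  ∈-bools true  = there (here refl)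

-- Colorings of n-subsets

module Colouring (em : ExcludedMiddle 0ℓ) {n d k c : ℕ}
  (COL : binom (ω^ d · fin k) n ⟶ₛ setoid (Fin c)) (r₀ : Fin c) where
  open TupleRamsey em
  open Ordinal d k

  Subsets : Set
  Subsets = Setoid.Carrier (binom S n)

  Enumerates : Subsets → (Fin n → ∣S∣) → Set
  Enumerates X z = ∀ s → s ∈ᵥ proj₁ X ⇔ (∃ λ i → z i ≡ s)

  enumerated-unique : ∀ {z} X X′ → Enumerates X z → Enumerates X′ z → COL ⟨$⟩ X ≡ COL ⟨$⟩ X′
  enumerated-unique (xs , lx) (xs′ , lx′) X≡ X′≡ = 
    Func.cong COL (Setoid.reflexive (Pointwise.setoid S.Eq.setoid n)
    (linked-unique (λ where refl → S.irrefl S.Eq.refl) S.trans lx lx′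
      (λ {s} s∈ → Equivalence.from (X′≡ s) (Equivalence.to (X≡ s) s∈))
      (λ {s} s∈ → Equivalence.from (X≡ s) (Equivalence.to (X′≡ s) s∈))))

  -- The list produced by placed follows the numbering of a coloring rule, not the
  -- order of S, and need not be injective.
  placed : Vec (Fin k) n → Vec ℕ (n * d) → Fin n → ∣S∣
  placed Y u i = lookup Y i , build (rows u i)

  -- Transfers `COL` to tuples of numbers, one coloring for each block assignment `Y`. The value
  -- `r₀` is arbitrary, for tuples that do not place n distinct elements.
  χ : Vec (Fin k) n → Vec ℕ (n * d) → Fin c
  χ Y u with em {∃ λ X → Enumerates X (placed Y u)}
  ... | yes (X , _) = COL ⟨$⟩ X
  ... | no  _       = r₀

  χ-enumerated : ∀ {Y u} X → Enumerates X (placed Y u) → χ Y u ≡ COL ⟨$⟩ X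
  χ-enumerated {Y} {u} X X≡ with em {∃ λ X → Enumerates X (placed Y u)}
  ... | yes (X′ , X′≡) = enumerated-unique X′ X X′≡ X≡
  ... | no  ¬X         = contradiction (X , X≡) ¬X

  module Thinned (h : ℕ → ℕ) (h-mono : StrictlyMonotone h)
    (χ-cong : ∀ Y u v → u ≈ₒ v → χ Y (Vec.map h u) ≡ χ Y (Vec.map h v)) where
    open Embedding {h} h-mono
    open Image em
    open Rule

    -- The color is read off from a chosen realising family. By `χ-cong` the choice is immaterial,
    -- as all families with this rule have order equivalent tuples.
    ruleColour : Candidate n d k → Fin c
    ruleColour σ with em {∃ λ y → Realises y σ}
    ... | yes (y , _) = χ (proj₁ σ) (Vec.map h (tuple y))
    ... | no  _       = r₀

    ruleColour-realised : ∀ σ y → Realises y σ → ruleColour σ ≡ χ (proj₁ σ) (Vec.map h (tuple y))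
    ruleColour-realised σ y real with em {∃ λ y → Realises y σ}
    ... | yes (y′ , real′) = χ-cong (proj₁ σ) (tuple y′) (tuple y) (realises⇒≈ₒ σ y′ y real′ real)
    ... | no  ¬real        = contradiction (y , real) ¬real

    placed-emb : ∀ y i → placed (blocks y) (Vec.map h (tuple y)) i ≡ emb (y i)
    placed-emb y i = cong₂ _,_ (lookup∘tabulate _ i) (cong build (begin
      rows (Vec.map h (tuple y)) i                  ≡⟨ tabulate-cong pointwise ⟩
      tabulate (lookup (Vec.map h (code (y i))))    ≡⟨ tabulate∘lookup _ ⟩
      Vec.map h (code (y i))                        ∎))
      where
      open ≡-Reasoning
      pointwise : ∀ l → lookup (Vec.map h (tuple y)) (combine i l) ≡ lookup (Vec.map h (code (y i))) l
      pointwise l = begin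
        lookup (Vec.map h (tuple y)) (combine i l) ≡⟨ lookup-map (combine i l) h (tuple y) ⟩
        h (lookup (tuple y) (combine i l))         ≡⟨ cong h (lookup-tuple y i l) ⟩
        h (lookup (code (y i)) l)                  ≡⟨ lookup-map l h (code (y i)) ⟨
        lookup (Vec.map h (code (y i))) l          ∎

    -- Pull `X` back along `emb` and list the preimages by increasing key. Their rule is the
    -- required one: placing their tuple, moved by `h`, lists `X` again, though in key order rather
    -- than in the order of `S`.
    colour-from-rule : ∀ X → Within S range X → ∃ λ σ → CR n d k σ × ruleColour σ ≡ COL ⟨$⟩ X
    colour-from-rule X@(xs , lxs) X⊆ = let π , π-mono , π-surj = sorting key-pre-injective in
      fromSorting π π-mono π-surj
      where
      pre : Fin n → ∣S∣
      pre t = proj₁ (preimage (All.lookup⁺ X⊆ t))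

      emb-pre : ∀ t → emb (pre t) ≡ lookup xs t
      emb-pre t = proj₂ (preimage (All.lookup⁺ X⊆ t))

      lookup-injective : ∀ {s t} → lookup xs s ≡ lookup xs t → s ≡ t
      lookup-injective {s} {t} eq with Fin.<-cmp s t
      ... | tri< s<t _ _ = contradiction (Linked.lookup⁺ S.trans lxs s<t) (S.irrefl (S.Eq.reflexive eq))
      ... | tri≈ _ s≡t _ = s≡t
      ... | tri> _ _ t<s = contradiction (Linked.lookup⁺ S.trans lxs t<s) (S.irrefl (S.Eq.reflexive (sym eq)))

      key-pre-injective : Injective _≡_ _≡_ (key ∘ pre)
      key-pre-injective {s} {t} eq = lookup-injective
        (trans (sym (emb-pre s)) (trans (cong emb (key-injective eq)) (emb-pre t)))

      fromSorting : (π : Fin n → Fin n) → (∀ {i j} → i Fin.< j → key (pre (π i)) < key (pre (π j))) →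
        StrictlySurjective _≡_ π → ∃ λ σ → CR n d k σ × ruleColour σ ≡ COL ⟨$⟩ X
      fromSorting π π-mono π-surj =
        σ , isCR y π-mono σ (realises y) ,
        trans (ruleColour-realised σ y (realises y)) (χ-enumerated {blocks y} {Vec.map h (tuple y)} X enumerates)
        where
        y : Fin n → ∣S∣
        y = pre ∘ π

        σ : Candidate n d k
        σ = blocks y , table y

        placed-y : ∀ i → placed (blocks y) (Vec.map h (tuple y)) i ≡ lookup xs (π i)
        placed-y i = trans (placed-emb y i) (emb-pre (π i))

        enumerates : Enumerates X (placed (blocks y) (Vec.map h (tuple y)))
        enumerates s = mk⇔ forward backward
          where
          forward : s ∈ᵥ xs → ∃ λ i → placed (blocks y) (Vec.map h (tuple y)) i ≡ s
          forward s∈ = let i , πi≡ = π-surj (Any.index s∈) in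
            i , trans (placed-y i) (trans (cong (lookup xs) πi≡) (sym (Any.lookup-index s∈)))
          backward : (∃ λ i → placed (blocks y) (Vec.map h (tuple y)) i ≡ s) → s ∈ᵥ xs
          backward (i , eq) = subst (_∈ᵥ xs) (trans (sym (placed-y i)) eq) (∈-lookup (π i) xs)

-- The bound on T

module _ (em : ExcludedMiddle 0ℓ) where
  open Classical em

  ∈-image⁻ : ∀ S {n c} (COL : binom S n ⟶ₛ setoid (Fin c)) S′ {r} → r ∈ image S COL S′ →
             ∃ λ X → Within S S′ X × COL ⟨$⟩ X ≡ r
  ∈-image⁻ S COL S′ {r} r∈ = does⁻ em (trans (sym (lookup∘tabulate _ r)) ([]=⇒lookup r∈))

  atMost-P : ∀ n d k → AtMost n (ω^ d · fin k) (P n d k)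
  atMost-P n d k (suc c) _ COL =
    -- There are finitely many block assignments, so one `h` serves them all. The arbitrary color
    -- `zero` exists because `1 ≤ c`.
    let h , h-mono , χ-cong = ramsey-tuples (vectors (allFin k) n) χ in
    fromRamsey h h-mono λ Y → χ-cong (∈-vectors Y λ i → ∈-allFin (lookup Y i))
    where
    open TupleRamsey em
    open Colouring em {n} {d} {k} COL zero
    open Ordinal d k

    rules : List (Candidate n d k)
    rules = filter (CR? n d k) (candidates n d k)

    fromRamsey : (h : ℕ → ℕ) → StrictlyMonotone h →
      (∀ Y u v → u ≈ₒ v → χ Y (Vec.map h u) ≡ χ Y (Vec.map h v)) →
      ∃ λ S′ → (S ↾ S′) ≃ₒ S × ∣ image S COL S′ ∣ ≤ P n d k
    fromRamsey h h-mono χ-cong = range , range≃ ,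
      covered⇒∣p∣≤length ruleColour rules (image S COL range) covered
      where
      open Thinned h h-mono χ-cong
      open Embedding {h} h-mono
      open Image em

      covered : ∀ {r} → r ∈ image S COL range → ∃ λ σ → σ List.∈ rules × ruleColour σ ≡ r
      covered {r} r∈ =
        let X , X⊆ , X≡r = ∈-image⁻ S COL range r∈
            σ , cr , eq  = colour-from-rule X X⊆
        in σ , ∈-filter⁺ (CR? n d k) (∈-candidates σ) cr , trans eq X≡r

  least : {Q : ℕ → Set} → ∀ t → Q t → ∃ (IsLeast Q)
  least {Q} = <-rec _ λ t smaller Qt → search t smaller Qt
    where
    search : ∀ t → (∀ {s} → s < t → Q s → ∃ (IsLeast Q)) → Q t → ∃ (IsLeast Q)
    search t smaller Qt with em {∃ λ s → s < t × Q s}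
    ... | yes (s , s<t , Qs) = smaller s<t Qs
    ... | no  ¬smaller       = t , Qt , λ s Qs → ≮⇒≥ λ s<t → ¬smaller (s , s<t , Qs)

  -- A bound that is attained forces a least one to exist, so the infinite value of `T` is excluded.
  T≤ : ∀ n S t → AtMost n S t → T n S ≤⁺ [ t ]
  T≤ n S t atMost with em {∃ (IsLeast (AtMost n S))}
  ... | yes (_ , _ , minimal) = [≤ minimal t atMost ]
  ... | no  ¬least            = contradiction (least t atMost) ¬least

theorem9p3 : (em : ExcludedMiddle 0ℓ) (n d k : ℕ) →
    Classical.T em n (ω^ d · fin k) ≤⁺ [ P n d k ]
theorem9p3 em n d k = T≤ em n (ω^ d · fin k) (P n d k) (atMost-P em n d k)
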